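{- Let $G$ be a connected bipartite graph of order $n\geq 4$. If $\delta(G)\geq \frac{n+6}{8}$, then $pc(G)=2$.
   Context: All graphs are finite, simple and undirected; $\delta(G)$ is the minimum degree. In an edge-colored graph, a path is a proper path if no two adjacent (consecutive) edges of the path receive the same color. For a connected graph $G$, the proper connection number $pc(G)$ is the minimum number of colors in an edge-coloring of $G$ (adjacent edges may share colors) such that every pair of distinct vertices of $G$ is joined by at least one proper path. -}

module Defs where

open import Data.Nat using (ℕ; _+_; _*_; _≤_)
open import Data.Fin using (Fin)
open import Data.Bool using (Bool; true; false; if_then_else_)
open import Data.List using (List; []; _∷_; map; head; last; allFin)
open import Data.Nat.ListAction using (sum)
open import Data.List.Relation.Unary.Unique.Propositional using (Unique)
open import Data.Maybe using (just)
open import Data.Product using (Σ; _×_; ∃)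
open import Data.Unit using (⊤)
open import Relation.Binary.PropositionalEquality using (_≡_; _≢_)
open import Relation.Nullary using (¬_)

record Graph (n : ℕ) : Set where
  field
    adj     : Fin n → Fin n → Bool
    symm    : ∀ u v → adj u v ≡ adj v u
    irrefl  : ∀ v → adj v v ≡ false
open Graph public

module _ {n : ℕ} (G : Graph n) where

  degree : Fin n → ℕ
  degree v = sum (map (λ w → if adj G v w then 1 else 0) (allFin n))

  Chain : List (Fin n) → Set
  Chain []            = ⊤
  Chain (x ∷ [])      = ⊤
  Chain (x ∷ y ∷ r)   = (adj G x y ≡ true) × Chain (y ∷ r)

  Ends : List (Fin n) → Fin n → Fin n → Set
  Ends p u v = (head p ≡ just u) × (last p ≡ just v)

  Connected : Set
  Connected = ∀ u v → Σ (List (Fin n)) λ p → Chain p × Ends p u v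

  Bipartite : Set
  Bipartite = Σ (Fin n → Bool) λ part → ∀ u v → adj G u v ≡ true → part u ≢ part v

  -- An edge-colouring with k colours (value on the edge uv; values on non-edges are irrelevant).
  EdgeColouring : ℕ → Set
  EdgeColouring k = Σ (Fin n → Fin n → Fin k) λ c → ∀ u v → c u v ≡ c v u

  ProperCol : {k : ℕ} → (Fin n → Fin n → Fin k) → List (Fin n) → Set
  ProperCol c (x ∷ y ∷ z ∷ r) = (c x y ≢ c y z) × ProperCol c (y ∷ z ∷ r)
  ProperCol c _               = ⊤

  ProperPath : {k : ℕ} → (Fin n → Fin n → Fin k) → Fin n → Fin n → Set
  ProperPath c u v = Σ (List (Fin n)) λ p →
    Unique p × Chain p × Ends p u v × ProperCol c p

  ProperConnectedWith : ℕ → Set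
  ProperConnectedWith k = Σ (EdgeColouring k) λ col →
    ∀ u v → u ≢ v → ProperPath (Σ.proj₁ col) u v

  PcEq : ℕ → Set
  PcEq k = ProperConnectedWith k × (∀ j → ProperConnectedWith j → k ≤ j)

{-# OPTIONS --safe #-}

-- Let `part` be the bipartition.  If the edges are oriented and an arc a → b
-- gets colour `part a`, then every directed path is properly coloured.  So it
-- suffices to orient G such that any two vertices are joined by a directed path
-- in one of the two directions.
--
-- Start with both arcs on every edge and delete arcs as long as the digraph
-- stays strongly connected (Robbins).  An edge that keeps both arcs is a bridge.
-- If some vertices x and y are separated by all bridges, orienting the bridges
-- from the side of x to the side of y gives the desired orientation.  Otherwise
-- three bridges have pairwise disjoint sides.  Each side contains the disjoint
-- neighbourhoods of two adjacent vertices and some vertex is in none of the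
-- sides, which forces n ≥ 22 and so δ ≥ 4.  Then the complement of the three
-- sides contains two such neighbourhoods too, and 8 δ ≤ n, a contradiction.

module Submission where

open import Defs
open import Data.Bool using (Bool; true; false; not; _∧_; _∨_; if_then_else_)
open import Data.Bool.Properties using (∨-comm; ∨-identityʳ; ¬-not; not-¬; not-injective) renaming (_≟_ to _≟ᵇ_)
open import Data.Empty using (⊥; ⊥-elim)
open import Data.Fin using (Fin; zero; suc)
open import Data.Fin.Properties using (any?; _≟_)
open import Data.List using (List; []; _∷_; map; head; last; length; tabulate; allFin; cartesianProduct)
open import Data.List.Membership.Propositional using (_∈_; _∉_; find; lose)
open import Data.List.Membership.Propositional.Properties using (∈-map⁺; ∈-allFin; ∈-cartesianProduct⁺)
open import Data.List.Properties using (length-map; map-tabulate)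
open import Data.List.Relation.Unary.All as All using (All; []; _∷_)
open import Data.List.Relation.Unary.All.Properties using (¬All⇒Any¬; All¬⇒¬Any) renaming (map⁺ to All-map⁺)
open import Data.List.Relation.Unary.AllPairs using ([]; _∷_)
open import Data.List.Relation.Unary.Any using (Any; here; there) renaming (any? to anyList?)
open import Data.List.Relation.Unary.Unique.Propositional using (Unique)
open import Data.Maybe using (just)
open import Data.Nat using (ℕ; zero; suc; _+_; _*_; _≤_; _<_; z≤n; s≤s; _≤?_)
open import Data.Nat.ListAction using (sum)
open import Data.Nat.Properties hiding (_≟_)
open import Data.Nat.Solver using (module +-*-Solver)
open import Data.Product using (Σ; ∃; _×_; _,_; proj₁; proj₂; uncurry)
open import Data.Sum using (_⊎_; inj₁; inj₂; [_,_]; swap)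
open import Data.Unit using (tt)
open import Function using (_∘_; flip; const; case_of_)
open import Level using (0ℓ)
open import Relation.Binary using (Rel; Decidable)
open import Relation.Binary.Construct.Closure.ReflexiveTransitive using (Star; ε; _◅_; _◅◅_; _⋆; reverse)
open import Relation.Binary.PropositionalEquality using (_≡_; _≢_; refl; sym; trans; cong; cong₂; subst)
open import Relation.Nullary using (¬_; Dec; yes; no; does; contradiction)
open import Relation.Nullary.Decidable using (_×-dec_; _→-dec_; dec-true; dec-false; decidable-stable; from-no; ¬?)

true≢false : ∀ {b} → b ≡ true → b ≡ false → ⊥
true≢false refl ()

-- Used to show that adjacent vertices of a bipartite graph have no common neighbour.
no-three-bools : (a b c : Bool) → a ≢ b → a ≢ c → b ≢ c → ⊥
no-three-bools a b c a≢b a≢c b≢c = b≢c (not-injective (trans (sym (¬-not a≢b)) (¬-not a≢c)))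

-- Counting

indicator : Bool → ℕ
indicator b = if b then 1 else 0

count : ∀ {n} → (Fin n → Bool) → ℕ
count {zero}  f = 0
count {suc n} f = indicator (f zero) + count (f ∘ suc)

sum-tabulate-indicator : ∀ {n} (f : Fin n → Bool) → sum (tabulate (indicator ∘ f)) ≡ count f
sum-tabulate-indicator {zero}  f = refl
sum-tabulate-indicator {suc n} f = cong (indicator (f zero) +_) (sum-tabulate-indicator (f ∘ suc))

degree≡count : ∀ {n} (G : Graph n) v → degree G v ≡ count (adj G v)
degree≡count G v = trans (cong sum (map-tabulate (λ i → i) (indicator ∘ adj G v))) (sum-tabulate-indicator (adj G v))

count≤n : ∀ {n} (f : Fin n → Bool) → count f ≤ n
count≤n {zero}  f = z≤n
count≤n {suc n} f = +-mono-≤ (indicator≤1 (f zero)) (count≤n (f ∘ suc))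
  where
  indicator≤1 : ∀ b → indicator b ≤ 1
  indicator≤1 false = z≤n
  indicator≤1 true  = s≤s z≤n

indicator-mono : ∀ a b → (a ≡ true → b ≡ true) → indicator a ≤ indicator b
indicator-mono false b     _   = z≤n
indicator-mono true  true  _   = s≤s z≤n
indicator-mono true  false imp = case imp refl of λ ()

count-mono : ∀ {n} (f g : Fin n → Bool) → (∀ x → f x ≡ true → g x ≡ true) → count f ≤ count g
count-mono {zero}  f g f⊆g = z≤n
count-mono {suc n} f g f⊆g =
  +-mono-≤ (indicator-mono (f zero) (g zero) (f⊆g zero)) (count-mono (f ∘ suc) (g ∘ suc) (f⊆g ∘ suc))

count-disjoint : ∀ {n} (f g h : Fin n → Bool) →
                 (∀ x → f x ≡ true → h x ≡ true) → (∀ x → g x ≡ true → h x ≡ true) →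
                 (∀ x → f x ≡ true → g x ≡ true → ⊥) → count f + count g ≤ count h
count-disjoint {zero}  f g h f⊆h g⊆h f#g = z≤n
count-disjoint {suc n} f g h f⊆h g⊆h f#g = begin
  (indicator (f zero) + count (f ∘ suc)) + (indicator (g zero) + count (g ∘ suc))
    ≡⟨ solve 4 (λ a b c d → (a :+ b) :+ (c :+ d) := (a :+ c) :+ (b :+ d)) refl (indicator (f zero)) (count (f ∘ suc)) (indicator (g zero)) (count (g ∘ suc)) ⟩
  (indicator (f zero) + indicator (g zero)) + (count (f ∘ suc) + count (g ∘ suc))
    ≤⟨ +-mono-≤ (bits (f zero) (g zero) (f⊆h zero) (g⊆h zero) (f#g zero)) (count-disjoint (f ∘ suc) (g ∘ suc) (h ∘ suc) (f⊆h ∘ suc) (g⊆h ∘ suc) (f#g ∘ suc)) ⟩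
  indicator (h zero) + count (h ∘ suc) ∎
  where
  open ≤-Reasoning
  open +-*-Solver
  bits : ∀ a b {c} → (a ≡ true → c ≡ true) → (b ≡ true → c ≡ true) → (a ≡ true → b ≡ true → ⊥) →
         indicator a + indicator b ≤ indicator c
  bits true  true  _ _ a#b = ⊥-elim (a#b refl refl)
  bits true  false {c} p _ _ = indicator-mono true c p
  bits false b     {c} _ q _ = indicator-mono b c q

count-positive : ∀ {n} (f : Fin n → Bool) x → f x ≡ true → 1 ≤ count f
count-positive f zero    fx rewrite fx = s≤s z≤n
count-positive f (suc x) fx = ≤-trans (count-positive (f ∘ suc) x fx) (m≤n+m _ (indicator (f zero)))

_is_ : ∀ {n} → Fin n → Fin n → Bool
x is y = does (x ≟ y)

is-refl : ∀ {n} (x : Fin n) → x is x ≡ true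
is-refl x = dec-true (x ≟ x) refl

is⇒≡ : ∀ {n} {x y : Fin n} → x is y ≡ true → x ≡ y
is⇒≡ {x = x} {y} eq with x ≟ y
... | yes x≡y = x≡y

_without_ : ∀ {n} → (Fin n → Bool) → Fin n → Fin n → Bool
(f without x) w = f w ∧ not (w is x)

without⁺ : ∀ {n} (f : Fin n → Bool) {x w} → f w ≡ true → w ≢ x → (f without x) w ≡ true
without⁺ f {x} {w} fw w≢x rewrite fw | dec-false (w ≟ x) w≢x = refl

without⁻ : ∀ {n} (f : Fin n → Bool) {x w} → (f without x) w ≡ true → f w ≡ true × w ≢ x
without⁻ f {x} {w} eq with f w | w ≟ x
... | true | no w≢x = refl , w≢x

count-without : ∀ {n} (f : Fin n → Bool) x → count f ≤ suc (count (f without x))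
count-without {suc n} f zero with f zero
... | true  = s≤s (count-mono (f ∘ suc) _ λ w fw → without⁺ f {zero} fw λ ())
... | false = ≤-trans (count-mono (f ∘ suc) _ λ w fw → without⁺ f {zero} fw λ ()) (n≤1+n _)
count-without {suc n} f (suc x) with f zero
... | true  = s≤s (count-without (f ∘ suc) x)
... | false = count-without (f ∘ suc) x

-- Each entry of `l` takes at most one element away from `f`, so `l` may contain repetitions and
-- vertices outside `f`.
pigeonhole : ∀ {n} (f : Fin n → Bool) (l : List (Fin n)) → length l < count f →
             ∃ λ w → f w ≡ true × w ∉ l
pigeonhole {n} f [] 0<count with any? (λ w → f w ≟ᵇ true)
... | yes (w , fw) = w , fw , λ ()
... | no none = contradiction (<-≤-trans 0<count (empty f λ w fw → none (w , fw))) λ ()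
  where
  empty : ∀ {m} (g : Fin m → Bool) → (∀ w → g w ≡ true → ⊥) → count g ≤ 0
  empty {zero}  g _ = z≤n
  empty {suc m} g e with g zero in eq
  ... | true  = ⊥-elim (e zero eq)
  ... | false = empty (g ∘ suc) (e ∘ suc)
pigeonhole f (x ∷ l) big with pigeonhole (f without x) l (≤-pred (≤-trans big (count-without f x)))
... | w , fw , w∉l = w , proj₁ (without⁻ f fw) , λ { (here w≡x) → proj₂ (without⁻ f fw) w≡x ; (there w∈l) → w∉l w∈l }

-- Simple paths

-- The vertex list is an index, so that `Unique` and membership can speak about it; its shape
-- follows the patterns of `Chain` and `ProperCol`.
data Path {n : ℕ} (R : Rel (Fin n) 0ℓ) : Fin n → List (Fin n) → Fin n → Set where
  stop : ∀ {a} → Path R a (a ∷ []) a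
  step : ∀ {a b c q} → R a b → Path R b (b ∷ q) c → Path R a (a ∷ b ∷ q) c

module _ {n : ℕ} {R : Rel (Fin n) 0ℓ} where

  path-cons : ∀ {a b c p} → R a b → Path R b p c → Path R a (a ∷ p) c
  path-cons r stop       = step r stop
  path-cons r (step s p) = step r (step s p)

  path⇒star : ∀ {a p b} → Path R a p b → Star R a b
  path⇒star stop       = ε
  path⇒star (step r p) = r ◅ path⇒star p

  path-last : ∀ {a p b} → Path R a p b → last p ≡ just b
  path-last stop                = refl
  path-last (step _ stop)       = refl
  path-last (step _ (step r p)) = path-last (step r p)

  path-head : ∀ {a p b} → Path R a p b → head p ≡ just a
  path-head stop       = refl
  path-head (step _ _) = refl

SimplePath : ∀ {n} (R : Rel (Fin n) 0ℓ) → Fin n → Fin n → Set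
SimplePath R a b = ∃ λ p → Path R a p b × Unique p

module _ {n : ℕ} (R : Rel (Fin n) 0ℓ) (R? : Decidable R) (target : Fin n) where

  SimplePathInside : (Fin n → Bool) → Fin n → Set
  SimplePathInside S a = ∃ λ p → Path R a p target × Unique p × All (λ w → S w ≡ true) p

  Closed : (Fin n → Bool) → Set
  Closed S = ∀ a b → R a b → S b ≡ true → S a ≡ true

  -- The vertex added to S is not on the simple path inside S that it prolongs.
  grow : ∀ k S → count (not ∘ S) ≤ k → S target ≡ true → (∀ a → S a ≡ true → SimplePathInside S a) →
         ∃ λ S′ → S′ target ≡ true × Closed S′ × (∀ a → S′ a ≡ true → SimplePathInside S′ a)
  grow k S small S-target paths with any? (λ a → (S a ≟ᵇ false) ×-dec any? (λ b → R? a b ×-dec (S b ≟ᵇ true)))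
  ... | no none = S , S-target , closed , paths
    where
    closed : Closed S
    closed a b r Sb with S a in eq
    ... | true  = refl
    ... | false = ⊥-elim (none (a , eq , b , r , Sb))
  ... | yes (a , Sa , b , r , Sb) with k
  ...   | zero = contradiction (≤-trans (count-positive (not ∘ S) a (cong not Sa)) small) λ ()
  ...   | suc k′ = grow k′ S′ (≤-pred (≤-trans smaller small)) (widen target S-target) paths′
    where
    S′ : Fin n → Bool
    S′ w = S w ∨ (w is a)
    widen : ∀ w → S w ≡ true → S′ w ≡ true
    widen w Sw rewrite Sw = refl
    S′-cases : ∀ w → S′ w ≡ true → S w ≡ true ⊎ w ≡ a
    S′-cases w eq with S w
    ... | true  = inj₁ refl
    ... | false = inj₂ (is⇒≡ eq)
    S′a : S′ a ≡ true
    S′a rewrite Sa = is-refl a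
    smaller : suc (count (not ∘ S′)) ≤ count (not ∘ S)
    smaller = ≤-trans (+-monoˡ-≤ _ (count-positive (_is a) a (is-refl a)))
      (count-disjoint (_is a) (not ∘ S′) (not ∘ S)
        (λ w w-is-a → cong not (trans (cong S (is⇒≡ w-is-a)) Sa))
        (λ w S′w → cong not (¬-not λ Sw → true≢false (widen w Sw) (not-injective S′w)))
        (λ w w-is-a S′w → true≢false S′a (trans (cong S′ (sym (is⇒≡ w-is-a))) (not-injective S′w))))
    fresh : ∀ {p} → All (λ w → S w ≡ true) p → All (a ≢_) p
    fresh = All.map λ { Sw refl → true≢false Sw Sa }
    paths′ : ∀ w → S′ w ≡ true → SimplePathInside S′ w
    paths′ w S′w with S′-cases w S′w
    ... | inj₁ Sw with paths w Sw
    ...   | p , path , unique , inside = p , path , unique , All.map (widen _) inside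
    paths′ w S′w | inj₂ refl with paths b Sb
    ...   | p , path , unique , inside =
      a ∷ p , path-cons r path , fresh inside ∷ unique , S′a ∷ All.map (widen _) inside

  -- The set that `grow` returns contains `target` and is closed under `R`-predecessors, so a vertex
  -- outside it cannot reach `target`.
  simplePath? : ∀ a → SimplePath R a target ⊎ ¬ Star R a target
  simplePath? a with grow _ (_is target) ≤-refl (is-refl target) single
    where
    single : ∀ a → (a is target) ≡ true → SimplePathInside (_is target) a
    single a eq with is⇒≡ {x = a} eq
    ... | refl = a ∷ [] , stop , [] ∷ [] , is-refl a ∷ []
  ... | S , S-target , closed , paths with S a in Sa
  ...   | true with paths a Sa
  ...     | p , path , unique , _ = inj₁ (p , path , unique)
  simplePath? a | S , S-target , closed , paths | false = inj₂ λ s → true≢false (inside s) Sa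
    where
    inside : ∀ {w} → Star R w target → S w ≡ true
    inside ε       = S-target
    inside (r ◅ s) = closed _ _ r (inside s)

star⇒simplePath : ∀ {n} {R : Rel (Fin n) 0ℓ} → Decidable R → ∀ {a b} → Star R a b → SimplePath R a b
star⇒simplePath R? {a} {b} s with simplePath? _ R? b a
... | inj₁ path = path
... | inj₂ ¬s   = contradiction s ¬s

star? : ∀ {n} {R : Rel (Fin n) 0ℓ} → Decidable R → Decidable (Star R)
star? R? a b with simplePath? _ R? b a
... | inj₁ (_ , path , _) = yes (path⇒star path)
... | inj₂ ¬s             = no ¬s

star-preserves : ∀ {n} {R : Rel (Fin n) 0ℓ} (P : Fin n → Set) → (∀ {a b} → R a b → P a → P b) →
                 ∀ {a b} → Star R a b → P a → P b
star-preserves P closed ε       Pa = Pa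
star-preserves P closed (r ◅ s) Pa = star-preserves P closed s (closed r Pa)

-- Cuts with a single crossing edge

module _ {n : ℕ} (G : Graph n) where

  Adj : Rel (Fin n) 0ℓ
  Adj a b = adj G a b ≡ true

  Adj-sym : ∀ {a b} → Adj a b → Adj b a
  Adj-sym {a} {b} e = trans (symm G b a) e

  Adj-irrefl : ∀ {a} → ¬ Adj a a
  Adj-irrefl {a} e = true≢false e (irrefl G a)

  -- A bridge together with one of the two vertex classes that it joins. The chosen class gives the
  -- bridge a direction, from `inner` to `outer`.
  record Cut : Set where
    field
      side          : Fin n → Bool
      inner outer   : Fin n
      edge          : Adj inner outer
      inner-inside  : side inner ≡ true
      outer-outside : side outer ≡ false
      only          : ∀ a b → Adj a b → side a ≡ true → side b ≡ false → a ≡ inner × b ≡ outer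

    -- Naming each end by the side it lies on lets one argument serve for both ends.
    endpoint : Bool → Fin n
    endpoint true  = inner
    endpoint false = outer

    side-endpoint : ∀ i → side (endpoint i) ≡ i
    side-endpoint true  = inner-inside
    side-endpoint false = outer-outside

    constant-on-endpoints : (f : Fin n → Bool) → f inner ≡ f outer → ∀ i → f (endpoint i) ≡ f inner
    constant-on-endpoints f same true  = refl
    constant-on-endpoints f same false = sym same

    crossing : ∀ a b → Adj a b → side a ≢ side b → a ≡ endpoint (side a) × b ≡ endpoint (side b)
    crossing a b e differ with side a in eqa | side b in eqb
    ... | true  | true  = ⊥-elim (differ refl)
    ... | true  | false = only a b e eqa eqb
    ... | false | true  = let p , q = only b a (Adj-sym e) eqb eqa in q , p
    ... | false | false = ⊥-elim (differ refl)

    -- The first step that changes sides runs along the only crossing edge, so both of its ends are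
    -- on the path.
    visits-endpoints : ∀ {R : Rel (Fin n) 0ℓ} → (∀ {a b} → R a b → Adj a b) →
                       ∀ {a p b} → Path R a p b → side a ≢ side b → ∀ i → endpoint i ∈ p
    visits-endpoints R⇒Adj stop differ i = ⊥-elim (differ refl)
    visits-endpoints R⇒Adj (step {a} {c} r path) differ i with side a ≟ᵇ side c
    ... | yes same = there (visits-endpoints R⇒Adj path (differ ∘ trans same) i)
    ... | no differ′ with crossing a c (R⇒Adj r) differ′ | i ≟ᵇ side a
    ...   | a-end , _ | yes i≡ = here (trans (cong endpoint i≡) (sym a-end))
    ...   | _ , c-end | no i≢  = there (here (trans (cong endpoint i≡) (sym c-end)))
      where
      i≡ : i ≡ side c
      i≡ = not-injective (trans (sym (¬-not (i≢ ∘ sym))) (¬-not differ′))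

  open Cut

  opposite : Cut → Cut
  opposite C = record
    { side = not ∘ side C
    ; inner = outer C
    ; outer = inner C
    ; edge = Adj-sym (edge C)
    ; inner-inside = cong not (outer-outside C)
    ; outer-outside = cong not (inner-inside C)
    ; only = λ a b e a-out b-in →
        let p , q = only C b a (Adj-sym e) (not-injective b-in) (not-injective a-out) in q , p
    }

  oriented : Cut → Fin n → Cut
  oriented C x = if side C x then C else opposite C

  oriented-inside : ∀ C x → side (oriented C x) x ≡ true
  oriented-inside C x with side C x in eq
  ... | true  = eq
  ... | false = cong not eq

  oriented-outside : ∀ C x y → side C x ≢ side C y → side (oriented C x) y ≡ false
  oriented-outside C x y differ with side C x | side C y in eq
  ... | true  | true  = ⊥-elim (differ refl)
  ... | true  | false = eq
  ... | false | true  = cong not eq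
  ... | false | false = ⊥-elim (differ refl)

  oriented-edge : ∀ C x → (inner (oriented C x) ≡ inner C × outer (oriented C x) ≡ outer C)
                        ⊎ (inner (oriented C x) ≡ outer C × outer (oriented C x) ≡ inner C)
  oriented-edge C x with side C x
  ... | true  = inj₁ (refl , refl)
  ... | false = inj₂ (refl , refl)

  -- Pairs of cuts in a connected graph

  module Connectivity (connected : ∀ a b → Star Adj a b) where

    closed-total : (P : Fin n → Set) → (∀ {a b} → Adj a b → P a → P b) → ∀ {a} → P a → ∀ b → P b
    closed-total P closed {a} Pa b = star-preserves P closed (connected a b) Pa

    module _ (P Q : Cut) where

      Quadrant : Bool → Bool → Fin n → Set
      Quadrant i j w = side P w ≡ i × side Q w ≡ j

      -- An edge that leaves the quadrant crosses `P` or `Q` and starts at the end of that cut on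
      -- side `i` or `j`. Neither end lies in the quadrant, so by connectedness the quadrant is the
      -- whole graph.
      isolated-quadrant : ∀ i j → side Q (endpoint P i) ≢ j → side P (endpoint Q j) ≢ i →
                          ∀ {w} → Quadrant i j w → ∀ w′ → Quadrant i j w′
      isolated-quadrant i j p-away q-away = closed-total (Quadrant i j) closed
        where
        closed : ∀ {a b} → Adj a b → Quadrant i j a → Quadrant i j b
        closed {a} {b} e (refl , refl) with side P a ≟ᵇ side P b
        ... | no differ = ⊥-elim (p-away (cong (side Q) (sym (proj₁ (crossing P a b e differ)))))
        ... | yes same with side Q a ≟ᵇ side Q b
        ...   | no differ = ⊥-elim (q-away (cong (side P) (sym (proj₁ (crossing Q a b e differ)))))
        ...   | yes same′ = sym same , sym same′

      -- Two cuts never cross: their two edges cannot connect four nonempty quadrants. Each case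
      -- finds an isolated quadrant or contradicts the sides of the ends.
      empty-quadrant : (∀ i j → ∃ (Quadrant i j)) → ⊥
      empty-quadrant nonempty = cases (side Q (inner P) ≟ᵇ side Q (outer P)) (side P (inner Q) ≟ᵇ side P (outer Q))
        where
        isolated-false : ∀ i j → side Q (endpoint P i) ≢ j → side P (endpoint Q j) ≢ i → ⊥
        isolated-false i j p-away q-away =
          let w , inside = nonempty i j
              w′ , eq , _ = nonempty (not i) j
          in not-¬ refl (trans (sym (proj₁ (isolated-quadrant i j p-away q-away inside w′))) eq)
        cases : Dec (side Q (inner P) ≡ side Q (outer P)) → Dec (side P (inner Q) ≡ side P (outer Q)) → ⊥
        -- The edge of `P` crosses `Q`, so both cuts have the same edge, which joins two diagonally
        -- opposite quadrants. The quadrant in `P` on the `Q`-side of `outer P` is not touched.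
        cases (no differ) _ = isolated-false true (side Q (outer P)) differ λ eq →
          true≢false (trans (cong (side P) (proj₂ (crossing Q _ _ (edge P) differ))) eq) (outer-outside P)
        -- The edge of `Q` crosses `P`, so its ends are those of `P`; but these lie on one side of
        -- `Q`.
        cases (yes same) (no differ) =
          let eq , eq′ = crossing P _ _ (edge Q) differ
              const-Q  = constant-on-endpoints P (side Q) same
          in true≢false (trans (sym (trans (cong (side Q) eq) (const-Q (side P (inner Q))))) (inner-inside Q))
                        (trans (sym (trans (cong (side Q) eq′) (const-Q (side P (outer Q))))) (outer-outside Q))
        -- Each edge stays on one side of the other cut; the quadrant opposite to both is touched by
        -- neither edge.
        cases (yes same) (yes same′) = isolated-false (not (side P (inner Q))) (not (side Q (inner P)))
          (not-¬ (constant-on-endpoints P (side Q) same (not (side P (inner Q)))))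
          (not-¬ (constant-on-endpoints Q (side P) same′ (not (side Q (inner P)))))

      -- The three given vertices occupy three quadrants, so the fourth is empty.
      disjoint-sides : ∀ {x y z} → Quadrant true false x → Quadrant false true y → Quadrant false false z →
                       ∀ w → side P w ≡ true → side Q w ≡ true → ⊥
      disjoint-sides in-P in-Q in-none w w-P w-Q = empty-quadrant λ
        { true  true  → _ , w-P , w-Q
        ; true  false → _ , in-P
        ; false true  → _ , in-Q
        ; false false → _ , in-none
        }

      -- If `outer P` were in the side of `Q`, both cuts would have the same edge in opposite
      -- directions. Leaving one side would then lead into the other, and the two sides would cover
      -- the graph, including `z`.
      outer-avoids : (∀ w → side P w ≡ true → side Q w ≡ true → ⊥) →
                     ∀ {z} → side P z ≡ false → side Q z ≡ false → side Q (outer P) ≡ false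
      outer-avoids disjoint {z} z-P z-Q = ¬-not λ outer-in-Q →
        let inner-not-Q = ¬-not (disjoint (inner P) (inner-inside P))
            eq , eq′ = only Q _ _ (Adj-sym (edge P)) outer-in-Q inner-not-Q
            closed : ∀ {a b} → Adj a b → side P a ≡ true ⊎ side Q a ≡ true → side P b ≡ true ⊎ side Q b ≡ true
            closed {a} {b} = λ
              { e (inj₁ a-P) → case side P b ≟ᵇ true of λ
                { (yes b-P) → inj₁ b-P
                ; (no b∉P) → inj₂ (trans (cong (side Q) (proj₂ (only P a b e a-P (¬-not b∉P)))) outer-in-Q) }
              ; e (inj₂ a-Q) → case side Q b ≟ᵇ true of λ
                { (yes b-Q) → inj₂ b-Q
                ; (no b∉Q) → inj₁ (trans (cong (side P) (trans (proj₂ (only Q a b e a-Q (¬-not b∉Q))) (sym eq′))) (inner-inside P)) }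
              }
        in [ flip true≢false z-P , flip true≢false z-Q ]
             (closed-total (λ w → side P w ≡ true ⊎ side Q w ≡ true) closed (inj₁ (inner-inside P)) z)

  -- Robbins orientation

  delete : (D : Fin n → Fin n → Bool) → Fin n → Fin n → Fin n → Fin n → Bool
  delete D u v a b = D a b ∧ not ((a is u) ∧ (b is v))

  Arc : (Fin n → Fin n → Bool) → Rel (Fin n) 0ℓ
  Arc D a b = D a b ≡ true

  Arc? : ∀ D → Decidable (Arc D)
  Arc? D a b = D a b ≟ᵇ true

  delete-⊆ : ∀ D {u v a b} → Arc (delete D u v) a b → Arc D a b
  delete-⊆ D {u} {v} {a} {b} arc with D a b
  ... | true = refl

  delete-keeps : ∀ D u v {a b} → Arc D a b → (a ≡ u × b ≡ v) ⊎ Arc (delete D u v) a b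
  delete-keeps D u v {a} {b} arc with a ≟ u | b ≟ v
  ... | yes a≡u | yes b≡v = inj₁ (a≡u , b≡v)
  ... | yes _   | no _    rewrite arc = inj₂ refl
  ... | no _    | _       rewrite arc = inj₂ refl

  delete-deletes : ∀ D u v → ¬ Arc (delete D u v) u v
  delete-deletes D u v arc rewrite is-refl u | is-refl v with D u v
  delete-deletes D u v () | true
  delete-deletes D u v () | false

  -- A partially oriented graph: an edge with both arcs is still undirected.
  record Mixed : Set where
    field
      arc     : Fin n → Fin n → Bool
      arc⇒Adj : ∀ {a b} → Arc arc a b → Adj a b
      covers  : ∀ {a b} → Adj a b → Arc arc a b ⊎ Arc arc b a
      strong  : ∀ a b → Star (Arc arc) a b

  open Mixed

  Bidirected : Mixed → Rel (Fin n) 0ℓ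
  Bidirected M a b = Arc (arc M) a b × Arc (arc M) b a

  -- Walks replace the deleted arc by the detour, and the reverse arc still covers the edge.
  delete-arc : ∀ M {u v} → Bidirected M u v → Star (Arc (delete (arc M) u v)) u v → Mixed
  delete-arc M {u} {v} (uv , vu) detour = record
    { arc     = delete (arc M) u v
    ; arc⇒Adj = arc⇒Adj M ∘ delete-⊆ (arc M)
    ; covers  = [ cover , swap ∘ cover ] ∘ covers M
    ; strong  = λ a b → (reroute ⋆) (strong M a b)
    }
    where
    cover : ∀ {a b} → Arc (arc M) a b → Arc (delete (arc M) u v) a b ⊎ Arc (delete (arc M) u v) b a
    cover ab with delete-keeps (arc M) u v ab
    ... | inj₂ kept = inj₁ kept
    ... | inj₁ (refl , refl) with delete-keeps (arc M) u v vu
    ...   | inj₁ (refl , _) = ⊥-elim (Adj-irrefl (arc⇒Adj M uv))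
    ...   | inj₂ kept = inj₂ kept
    reroute : ∀ {a b} → Arc (arc M) a b → Star (Arc (delete (arc M) u v)) a b
    reroute ab with delete-keeps (arc M) u v ab
    ... | inj₁ (refl , refl) = detour
    ... | inj₂ kept = kept ◅ ε

  -- The vertices reachable from u without the arc uv and those reachable from v
  -- without vu partition the graph, and only the edge uv joins the two classes.
  stuck-cut : ∀ M {u v} → Bidirected M u v →
              ¬ Star (Arc (delete (arc M) u v)) u v → ¬ Star (Arc (delete (arc M) v u)) v u →
              ∃ λ C → inner C ≡ u × outer C ≡ v
  stuck-cut M {u} {v} (uv , vu) no-detour no-detour′ = record
    { side = λ w → does (S? w)
    ; inner = u
    ; outer = v
    ; edge = arc⇒Adj M uv
    ; inner-inside = dec-true (S? u) ε
    ; outer-outside = dec-false (S? v) no-detour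
    ; only = λ a b e a-in b-out → only′ e (does-true (S? a) a-in) (does-false (S? b) b-out)
    } , refl , refl
    where
    does-true : ∀ {A : Set} (A? : Dec A) → does A? ≡ true → A
    does-true (yes a) _ = a
    does-false : ∀ {A : Set} (A? : Dec A) → does A? ≡ false → ¬ A
    does-false (no ¬a) _ = ¬a
    D : Fin n → Fin n → Bool
    D = arc M
    S T : Fin n → Set
    S = Star (Arc (delete D u v)) u
    T = Star (Arc (delete D v u)) v
    S? : ∀ w → Dec (S w)
    S? = star? (Arc? (delete D u v)) u
    S-step : ∀ {a b} → Arc D a b → S a → (a ≡ u × b ≡ v) ⊎ S b
    S-step ab Sa with delete-keeps D u v ab
    ... | inj₁ eqs  = inj₁ eqs
    ... | inj₂ kept = inj₂ (Sa ◅◅ kept ◅ ε)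
    T-step : ∀ {a b} → Arc D a b → T a → (a ≡ v × b ≡ u) ⊎ T b
    T-step ab Ta with delete-keeps D v u ab
    ... | inj₁ eqs  = inj₁ eqs
    ... | inj₂ kept = inj₂ (Ta ◅◅ kept ◅ ε)
    cover-step : ∀ {a b} → Arc D a b → S a ⊎ T a → S b ⊎ T b
    cover-step ab (inj₁ Sa) with S-step ab Sa
    ... | inj₁ (_ , refl) = inj₂ ε
    ... | inj₂ Sb = inj₁ Sb
    cover-step ab (inj₂ Ta) with T-step ab Ta
    ... | inj₁ (_ , refl) = inj₁ ε
    ... | inj₂ Tb = inj₂ Tb
    cover : ∀ b → S b ⊎ T b
    cover b = star-preserves (λ w → S w ⊎ T w) cover-step (strong M v b) (inj₂ ε)
    -- A vertex reached from both `u` and `v` would pass this on along every arc, hence by strong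
    -- connectivity to `u`, where it contradicts `no-detour′`.
    meet-step : ∀ {a b} → Arc D a b → S a × T a → S b × T b
    meet-step ab (Sa , Ta) with S-step ab Sa | T-step ab Ta
    ... | inj₁ (refl , _) | _ = ⊥-elim (no-detour′ Ta)
    ... | inj₂ _ | inj₁ (refl , _) = ⊥-elim (no-detour Sa)
    ... | inj₂ Sb | inj₂ Tb = Sb , Tb
    disjoint : ∀ {a} → S a → ¬ T a
    disjoint {a} Sa Ta = no-detour′ (proj₂ (star-preserves (λ w → S w × T w) meet-step (strong M a u) (Sa , Ta)))
    only′ : ∀ {a b} → Adj a b → S a → ¬ S b → a ≡ u × b ≡ v
    only′ {a} {b} e Sa ¬Sb with covers M e
    ... | inj₁ ab with S-step ab Sa
    ...   | inj₁ eqs = eqs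
    ...   | inj₂ Sb = contradiction Sb ¬Sb
    only′ {a} {b} e Sa ¬Sb | inj₂ ba with cover b
    ...   | inj₁ Sb = contradiction Sb ¬Sb
    ...   | inj₂ Tb with T-step ba Tb
    ...     | inj₁ (b≡v , a≡u) = a≡u , b≡v
    ...     | inj₂ Ta = contradiction Ta (disjoint Sa)

  IsEdgeOf : Fin n → Fin n → Cut → Set
  IsEdgeOf a b C = inner C ≡ a × outer C ≡ b

  refine : ∀ M u v → Σ Mixed λ M′ → (∀ {a b} → Arc (arc M′) a b → Arc (arc M) a b) ×
                     (¬ Bidirected M′ u v ⊎ ∃ (IsEdgeOf u v))
  refine M u v with Arc? (arc M) u v ×-dec Arc? (arc M) v u
  ... | no single = M , (λ arc → arc) , inj₁ single
  ... | yes both@(uv , vu) with star? (Arc? (delete (arc M) u v)) u v | star? (Arc? (delete (arc M) v u)) v u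
  ...   | yes detour | _ = delete-arc M both detour , delete-⊆ (arc M) , inj₁ (delete-deletes (arc M) u v ∘ proj₁)
  ...   | no _ | yes detour = delete-arc M (vu , uv) detour , delete-⊆ (arc M) , inj₁ (delete-deletes (arc M) v u ∘ proj₂)
  ...   | no no-detour | no no-detour′ = M , (λ arc → arc) , inj₂ (stuck-cut M both no-detour no-detour′)

  -- One pass is enough: a lost arc never returns, and a `Cut` refers to the graph and not to the
  -- digraph, so it survives later deletions.
  refine-all : Mixed → (l : List (Fin n × Fin n)) →
               Σ Mixed λ M → Σ (List Cut) λ bridges →
               ∀ {a b} → (a , b) ∈ l → Bidirected M a b → Any (IsEdgeOf a b) bridges
  refine-all M [] = M , [] , λ ()
  refine-all M ((u , v) ∷ l) with refine-all M l
  ... | M₁ , bridges , bridge with refine M₁ u v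
  ...   | M₂ , M₂⊆M₁ , inj₁ single = M₂ , bridges , λ
          { (here refl) both → ⊥-elim (single both)
          ; (there ab∈l) (ab , ba) → bridge ab∈l (M₂⊆M₁ ab , M₂⊆M₁ ba) }
  ...   | M₂ , M₂⊆M₁ , inj₂ (C , C-edge) = M₂ , C ∷ bridges , λ
          { (here refl) both → here C-edge
          ; (there ab∈l) (ab , ba) → there (bridge ab∈l (M₂⊆M₁ ab , M₂⊆M₁ ba)) }

  robbins : (∀ a b → Star Adj a b) →
            Σ Mixed λ M → Σ (List Cut) λ bridges → ∀ {a b} → Bidirected M a b → Any (IsEdgeOf a b) bridges
  robbins connected with refine-all undirected (cartesianProduct (allFin n) (allFin n))
    where
    undirected : Mixed
    undirected = record { arc = adj G ; arc⇒Adj = λ e → e ; covers = inj₁ ; strong = connected }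
  ... | M , bridges , bridge = M , bridges , bridge (∈-cartesianProduct⁺ (∈-allFin _) (∈-allFin _))

  -- Orienting the bridges

  module Unilateral
    (connected : ∀ a b → Star Adj a b)
    (M : Mixed) (bridges : List Cut)
    (bridge : ∀ {a b} → Bidirected M a b → Any (IsEdgeOf a b) bridges)
    (x y : Fin n) (separated : All (λ C → side C x ≢ side C y) bridges)
    where

    open Connectivity connected

    -- Every bridge is turned to point from the side of `x` to the side of `y`.
    cuts : List Cut
    cuts = map (λ C → oriented C x) bridges

    cuts-separate : All (λ Q → side Q x ≡ true × side Q y ≡ false) cuts
    cuts-separate = All-map⁺ (All.map (λ {C} differ → oriented-inside C x , oriented-outside C x y differ) separated)

    Forward : Rel (Fin n) 0ℓ
    Forward a b = Any (IsEdgeOf a b) cuts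

    Forward? : Decidable Forward
    Forward? a b = anyList? (λ C → (inner C ≟ a) ×-dec (outer C ≟ b)) cuts

    Oriented : Rel (Fin n) 0ℓ
    Oriented a b = Arc (arc M) a b × (Arc (arc M) b a → Forward a b)

    Oriented? : Decidable Oriented
    Oriented? a b = Arc? (arc M) a b ×-dec (Arc? (arc M) b a →-dec Forward? a b)

    bidirected-forward : ∀ {a b} → Bidirected M a b → Forward a b ⊎ Forward b a
    bidirected-forward both with find (bridge both)
    ... | C , C∈ , refl , refl with oriented-edge C x
    ...   | inj₁ eqs = inj₁ (lose (∈-map⁺ (λ C → oriented C x) C∈) eqs)
    ...   | inj₂ eqs = inj₂ (lose (∈-map⁺ (λ C → oriented C x) C∈) eqs)

    -- All cuts have `x` inside and `y` outside, which fills two opposite quadrants. The other two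
    -- cannot both be occupied, so the sides form a chain under inclusion.
    cuts-nested : ∀ {P Q a b} → P ∈ cuts → Q ∈ cuts → side P a ≡ true → side P b ≡ false →
                  side Q a ≡ false → side Q b ≡ true → ⊥
    cuts-nested {P} {Q} P∈ Q∈ Pa Pb Qa Qb =
      let Px , Py = All.lookup cuts-separate P∈
          Qx , Qy = All.lookup cuts-separate Q∈
      in empty-quadrant P Q λ
        { true  true  → x , Px , Qx
        ; true  false → _ , Pa , Qa
        ; false true  → _ , Pb , Qb
        ; false false → y , Py , Qy
        }

    Forward-asym : ∀ {a b} → Forward a b → ¬ Forward b a
    Forward-asym ab ba with find ab | find ba
    ... | P , P∈ , refl , refl | Q , Q∈ , eq , eq′ =
      cuts-nested P∈ Q∈ (inner-inside P) (outer-outside P)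
        (trans (cong (side Q) (sym eq′)) (outer-outside Q)) (trans (cong (side Q) (sym eq)) (inner-inside Q))

    Oriented-asym : ∀ {a b} → Oriented a b → ¬ Oriented b a
    Oriented-asym (ab , ab-forward) (ba , ba-forward) = Forward-asym (ab-forward ba) (ba-forward ab)

    Oriented⇒Adj : ∀ {a b} → Oriented a b → Adj a b
    Oriented⇒Adj (ab , _) = arc⇒Adj M ab

    -- Progress from `x` to `y` along the chain of cuts: `b` has passed every cut that `a` has
    -- passed.
    _≼_ : Rel (Fin n) 0ℓ
    a ≼ b = All (λ Q → side Q a ≡ false → side Q b ≡ false) cuts

    ≼-total : ∀ a b → a ≼ b ⊎ b ≼ a
    ≼-total a b with All.all? (λ Q → (side Q a ≟ᵇ false) →-dec (side Q b ≟ᵇ false)) cuts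
    ... | yes a≼b = inj₁ a≼b
    ... | no a⋠b with find (¬All⇒Any¬ (λ Q → (side Q a ≟ᵇ false) →-dec (side Q b ≟ᵇ false)) cuts a⋠b)
    ...   | P , P∈ , ¬imp with side P a in Pa | side P b in Pb
    ...     | _     | false = ⊥-elim (¬imp λ _ → refl)
    ...     | true  | true  = ⊥-elim (¬imp λ ())
    ...     | false | true  = inj₂ (All.tabulate λ {Q} Q∈ Qb →
                                ¬-not λ Qa → cuts-nested Q∈ P∈ Qa Qb Pa Pb)

    -- A simple path cannot cross a bridge twice, so it crosses the bridges in
    -- the direction that a ≼ b prescribes.
    path-oriented : ∀ {a p b} → Path (Arc (arc M)) a p b → Unique p → a ≼ b → Star Oriented a b
    path-oriented stop _ _ = ε
    path-oriented (step {a} {c} {b} {q} ac path) (a∉ ∷ unique) a≼b =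
      (ac , ac-forward) ◅ path-oriented path unique (All.tabulate c≼b)
      where
      not-on-path : a ∉ c ∷ q
      not-on-path = All¬⇒¬Any a∉
      c≼b : ∀ {Q} → Q ∈ cuts → side Q c ≡ false → side Q b ≡ false
      c≼b {Q} Q∈ Qc with side Q a in Qa
      ... | false = All.lookup a≼b Q∈ Qa
      ... | true  = ¬-not λ Qb → not-on-path
              (subst (_∈ c ∷ q) (sym (proj₁ (only Q a c (arc⇒Adj M ac) Qa Qc)))
                (visits-endpoints Q (arc⇒Adj M) path (λ same → true≢false (trans same Qb) Qc) true))
      ac-forward : Arc (arc M) c a → Forward a c
      ac-forward ca with bidirected-forward (ac , ca)
      ... | inj₁ forward = forward
      -- Here `a` is `outer Q` and `c` is `inner Q`. Since `a ≼ b`, also `b` is outside `Q`, so the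
      -- rest of the path would have to return through `a`.
      ... | inj₂ backward with find backward
      ...   | Q , Q∈ , refl , refl = ⊥-elim (not-on-path (visits-endpoints Q (arc⇒Adj M) path
              (λ same → true≢false (trans (sym same) (inner-inside Q)) (All.lookup a≼b Q∈ (outer-outside Q))) false))

    unilateral : ∀ a b → Star Oriented a b ⊎ Star Oriented b a
    unilateral a b with ≼-total a b
    ... | inj₁ a≼b = inj₁ (let _ , path , unique = star⇒simplePath (Arc? (arc M)) (strong M a b) in path-oriented path unique a≼b)
    ... | inj₂ b≼a = inj₂ (let _ , path , unique = star⇒simplePath (Arc? (arc M)) (strong M b a) in path-oriented path unique b≼a)

  -- The degree condition

  module DegreeCondition
    (part : Fin n → Bool) (bipartite : ∀ u v → Adj u v → part u ≢ part v)
    (4≤n : 4 ≤ n) (large-degree : ∀ v → n + 6 ≤ 8 * degree G v)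
    where

    -- Each boundary pair spoils at most one neighbour of a vertex of `R`, so a degree above
    -- `length boundary` leaves a neighbour in `R` with no edge out of `R`. Doing this twice gives
    -- two adjacent such vertices; their neighbourhoods lie in `R` and are disjoint.
    room-size : (R : Fin n → Bool) (boundary : List (Fin n × Fin n)) →
                (∀ a b → Adj a b → R a ≡ true → R b ≡ false → (a , b) ∈ boundary) →
                (∀ v → length boundary < degree G v) →
                ∀ v → R v ≡ true → 2 * (n + 6) ≤ 8 * count R
    room-size R boundary leaves degrees v₀ Rv₀ =
      let w , _ , deep = deep-neighbour v₀ Rv₀
          w′ , ww′ , deep′ = deep-neighbour w (proj₁ deep)
      in two-neighbourhoods ww′ deep deep′
      where
      Deep : Fin n → Set
      Deep w = R w ≡ true × (∀ l → (w , l) ∉ boundary)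
      exit : Fin n → Fin n × Fin n → Fin n
      exit v (r , l) = if v is r then l else r
      -- A neighbour of v that is outside R or on the boundary has the form exit v e with e ∈ boundary.
      deep-neighbour : ∀ v → R v ≡ true → ∃ λ w → Adj v w × Deep w
      deep-neighbour v Rv with pigeonhole (adj G v) (map (exit v) boundary)
                                 (subst (_< count (adj G v)) (sym (length-map (exit v) boundary))
                                   (subst (length boundary <_) (degree≡count G v) (degrees v)))
      ... | w , vw , w∉ = w , vw , ¬-not inside , not-boundary
        where
        exit-outer : exit v (v , w) ≡ w
        exit-outer rewrite is-refl v = refl
        exit-inner : ∀ l → exit v (w , l) ≡ w
        exit-inner l rewrite dec-false (v ≟ w) (λ { refl → Adj-irrefl vw }) = refl
        inside : R w ≢ false
        inside w-out = w∉ (subst (_∈ map (exit v) boundary) exit-outer (∈-map⁺ (exit v) (leaves v w vw Rv w-out)))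
        not-boundary : ∀ l → (w , l) ∉ boundary
        not-boundary l wl∈ = w∉ (subst (_∈ map (exit v) boundary) (exit-inner l) (∈-map⁺ (exit v) wl∈))
      stays : ∀ {a} → Deep a → ∀ b → Adj a b → R b ≡ true
      stays {a} (Ra , deep) b ab = ¬-not λ b-out → deep b (leaves a b ab Ra b-out)
      two-neighbourhoods : ∀ {w w′} → Adj w w′ → Deep w → Deep w′ → 2 * (n + 6) ≤ 8 * count R
      two-neighbourhoods {w} {w′} ww′ deep deep′ = begin
        2 * (n + 6)                               ≡⟨ cong ((n + 6) +_) (+-identityʳ (n + 6)) ⟩
        (n + 6) + (n + 6)                         ≤⟨ +-mono-≤ (large-degree w) (large-degree w′) ⟩
        8 * degree G w + 8 * degree G w′          ≡⟨ *-distribˡ-+ 8 (degree G w) (degree G w′) ⟨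
        8 * (degree G w + degree G w′)            ≡⟨ cong (8 *_) (cong₂ _+_ (degree≡count G w) (degree≡count G w′)) ⟩
        8 * (count (adj G w) + count (adj G w′))  ≤⟨ *-monoʳ-≤ 8 (count-disjoint (adj G w) (adj G w′) R
                                                       (stays deep) (stays deep′) disjoint) ⟩
        8 * count R ∎
        where
        open ≤-Reasoning
        disjoint : ∀ a → Adj w a → Adj w′ a → ⊥
        disjoint a wa w′a = no-three-bools (part w) (part w′) (part a)
          (bipartite w w′ ww′) (bipartite w a wa) (bipartite w′ a w′a)

    -- Eight times the degree is at least 10, so the degree exceeds the one boundary edge of a side.
    degree>1 : ∀ v → 1 < degree G v
    degree>1 v = ≰⇒> λ small → contradiction
      (≤-trans (+-monoˡ-≤ 6 4≤n) (≤-trans (large-degree v) (*-monoʳ-≤ 8 small))) (from-no (10 ≤? 8))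

    -- Now eight times the degree is at least 28, so the degree exceeds the three boundary edges of
    -- the complement in `no-tripod`.
    degree>3 : 22 ≤ n → ∀ v → 3 < degree G v
    degree>3 22≤n v = ≰⇒> λ small → contradiction
      (≤-trans (+-monoˡ-≤ 6 22≤n) (≤-trans (large-degree v) (*-monoʳ-≤ 8 small))) (from-no (28 ≤? 24))

    side-size : ∀ C → 2 * (n + 6) ≤ 8 * count (side C)
    side-size C = room-size (side C) ((inner C , outer C) ∷ [])
      (λ a b e a-in b-out → here (uncurry (cong₂ _,_) (only C a b e a-in b-out)))
      degree>1 (inner C) (inner-inside C)

    module _ (connected : ∀ a b → Star Adj a b) where

      open Connectivity connected

      -- The three sides and their complement are four disjoint rooms, each with eight times its
      -- size at least `2 * (n + 6)`. Together this gives `8 * n + 48 ≤ 8 * n`.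
      no-tripod : ∀ A B C x y z →
                  side A x ≡ true  → side A y ≡ false → side A z ≡ false →
                  side B x ≡ false → side B y ≡ true  → side B z ≡ false →
                  side C x ≡ false → side C y ≡ false → side C z ≡ true → ⊥
      no-tripod A B C x y z Ax Ay Az Bx By Bz Cx Cy Cz = <⇒≱ too-big (sides _ rest-size)
        where
        A#B : ∀ w → side A w ≡ true → side B w ≡ true → ⊥
        A#B = disjoint-sides A B (Ax , Bx) (Ay , By) (Az , Bz)
        A#C : ∀ w → side A w ≡ true → side C w ≡ true → ⊥
        A#C = disjoint-sides A C (Ax , Cx) (Az , Cz) (Ay , Cy)
        B#C : ∀ w → side B w ≡ true → side C w ≡ true → ⊥
        B#C = disjoint-sides B C (By , Cy) (Bz , Cz) (Bx , Cx)
        A∪B A∪B∪C rest : Fin n → Bool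
        A∪B w = side A w ∨ side B w
        A∪B∪C w = A∪B w ∨ side C w
        rest w = not (A∪B∪C w)
        ∨⁻ : ∀ a {b} → a ∨ b ≡ true → a ≡ true ⊎ b ≡ true
        ∨⁻ true  _  = inj₁ refl
        ∨⁻ false eq = inj₂ eq
        ∨-left : ∀ {a} b → a ≡ true → a ∨ b ≡ true
        ∨-left _ refl = refl
        ∨-right : ∀ a {b} → b ≡ true → a ∨ b ≡ true
        ∨-right true  _  = refl
        ∨-right false eq = eq
        a b c r : ℕ
        a = count (side A)
        b = count (side B)
        c = count (side C)
        r = count rest
        fits : ((a + b) + c) + r ≤ n
        fits = begin
          ((a + b) + c) + r       ≤⟨ +-monoˡ-≤ r (+-monoˡ-≤ c (count-disjoint (side A) (side B) A∪B
                                       (λ w → ∨-left (side B w)) (λ w → ∨-right (side A w)) A#B)) ⟩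
          (count A∪B + c) + r     ≤⟨ +-monoˡ-≤ r (count-disjoint A∪B (side C) A∪B∪C
                                       (λ w → ∨-left (side C w)) (λ w → ∨-right (A∪B w))
                                       (λ w ab c → [ (λ a → A#C w a c) , (λ b → B#C w b c) ] (∨⁻ (side A w) ab))) ⟩
          count A∪B∪C + r         ≤⟨ count-disjoint A∪B∪C rest (const true) (λ _ _ → refl) (λ _ _ → refl)
                                       (λ w in-abc out → true≢false in-abc (not-injective out)) ⟩
          count {n} (const true)  ≤⟨ count≤n (const true) ⟩
          n ∎
          where open ≤-Reasoning
        -- The complement is nonempty: `z` keeps `outer A` out of `B`, and `y` keeps it out of `C`.
        in-rest : rest (outer A) ≡ true
        in-rest rewrite outer-outside A | outer-avoids A B A#B Az Bz | outer-avoids A C A#C Ay Cy = refl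
        eight-parts : 8 * (((a + b) + c) + r) ≡ ((8 * a + 8 * b) + 8 * c) + 8 * r
        eight-parts = solve 4 (λ a b c r → con 8 :* (((a :+ b) :+ c) :+ r)
          := ((con 8 :* a :+ con 8 :* b) :+ con 8 :* c) :+ con 8 :* r) refl a b c r
          where open +-*-Solver
        -- Used twice: with `k = 8`, from one vertex in the complement, to get `22 ≤ n`, and then
        -- with the full bound of `rest-size`.
        sides : ∀ k → k ≤ 8 * r → (2 * (n + 6) + 2 * (n + 6) + 2 * (n + 6)) + k ≤ 8 * n
        sides k k≤ = ≤-trans (+-mono-≤ (+-mono-≤ (+-mono-≤ (side-size A) (side-size B)) (side-size C)) k≤)
          (≤-trans (≤-reflexive (sym eight-parts)) (*-monoʳ-≤ 8 fits))
        22≤n : 22 ≤ n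
        22≤n = *-cancelˡ-≤ 2 (+-cancelˡ-≤ (6 * n) (2 * 22) (2 * n) (begin
          6 * n + 2 * 22
            ≡⟨ solve 1 (λ n → con 6 :* n :+ con 44 := (con 2 :* (n :+ con 6) :+ con 2 :* (n :+ con 6) :+ con 2 :* (n :+ con 6)) :+ con 8) refl n ⟩
          (2 * (n + 6) + 2 * (n + 6) + 2 * (n + 6)) + 8
            ≤⟨ sides 8 (*-monoʳ-≤ 8 (count-positive rest (outer A) in-rest)) ⟩
          8 * n
            ≡⟨ *-distribʳ-+ n 6 2 ⟩
          6 * n + 2 * n ∎))
          where
          open ≤-Reasoning
          open +-*-Solver
        boundary : List (Fin n × Fin n)
        -- Seen from the complement, the outer ends come first.
        boundary = (outer A , inner A) ∷ (outer B , inner B) ∷ (outer C , inner C) ∷ []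
        leaves : ∀ v w → Adj v w → rest v ≡ true → rest w ≡ false → (v , w) ∈ boundary
        leaves v w e v-rest w-out with side A v in Av | side B v in Bv | side C v in Cv | side A w in Aw | side B w in Bw | side C w in Cw
        ... | false | false | false | true  | _     | _    = here (let p , q = only A w v (Adj-sym e) Aw Av in cong₂ _,_ q p)
        ... | false | false | false | false | true  | _    = there (here (let p , q = only B w v (Adj-sym e) Bw Bv in cong₂ _,_ q p))
        ... | false | false | false | false | false | true = there (there (here (let p , q = only C w v (Adj-sym e) Cw Cv in cong₂ _,_ q p)))
        rest-size : 2 * (n + 6) ≤ 8 * r
        rest-size = room-size rest boundary leaves (degree>3 22≤n) (outer A) in-rest
        too-big : 8 * n < (2 * (n + 6) + 2 * (n + 6) + 2 * (n + 6)) + 2 * (n + 6)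
        too-big = subst (8 * n <_)
          (solve 1 (λ n → con 8 :* n :+ con 48 := (con 2 :* (n :+ con 6) :+ con 2 :* (n :+ con 6) :+ con 2 :* (n :+ con 6)) :+ con 2 :* (n :+ con 6)) refl n)
          (m<m+n (8 * n) (s≤s z≤n))
          where open +-*-Solver

      -- Induction on the list. If `C` does not separate the pair `x`, `y` found so far, the end `t`
      -- of `C` on the far side replaces `x` or `y`; when both replacements fail, there is a tripod.
      common-separation : (bridges : List Cut) → Fin n → ∃ λ x → ∃ λ y → All (λ C → side C x ≢ side C y) bridges
      common-separation [] v = v , v , []
      common-separation (C ∷ bridges) v with common-separation bridges v
      ... | x , y , separated with side C x ≟ᵇ side C y
      ...   | no differ = x , y , differ ∷ separated
      ...   | yes same = extend
                (All.all? (λ B → ¬? (side B x ≟ᵇ side B t)) bridges)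
                (All.all? (λ B → ¬? (side B t ≟ᵇ side B y)) bridges)
        where
        t : Fin n
        t = endpoint C (not (side C x))
        x|t : side C x ≢ side C t
        x|t = not-¬ refl ∘ flip trans (side-endpoint C _)
        shared : ∀ {u w} → ¬ All (λ B → side B u ≢ side B w) bridges →
                 ∃ λ B → B ∈ bridges × side B u ≡ side B w
        shared {u} {w} ¬all with find (¬All⇒Any¬ (λ B → ¬? (side B u ≟ᵇ side B w)) bridges ¬all)
        ... | B , B∈ , ¬differ = B , B∈ , decidable-stable (side B u ≟ᵇ side B w) ¬differ
        extend : Dec (All (λ B → side B x ≢ side B t) bridges) → Dec (All (λ B → side B t ≢ side B y) bridges) →
                 ∃ λ x → ∃ λ y → All (λ B → side B x ≢ side B y) (C ∷ bridges)
        extend (yes all) _ = x , t , x|t ∷ all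
        extend (no _) (yes all) = t , y , (λ eq → x|t (trans same (sym eq))) ∷ all
        extend (no ¬all) (no ¬all′) with shared ¬all | shared ¬all′
        -- `B` cuts off `y` from `x` and `t`, `B′` cuts off `x` from `t` and `y`, and `C` cuts off
        -- `t` from `x` and `y`.
        ... | B , B∈ , Bx≡Bt | B′ , B′∈ , B′t≡B′y =
          let x|y  = All.lookup separated B∈
              x|y′ = All.lookup separated B′∈
          in ⊥-elim (no-tripod (oriented C t) (oriented B y) (oriented B′ x) t y x
               (oriented-inside C t) (oriented-outside C t y (λ eq → x|t (trans same (sym eq)))) (oriented-outside C t x (x|t ∘ sym))
               (oriented-outside B y t (λ eq → x|y (trans Bx≡Bt (sym eq)))) (oriented-inside B y) (oriented-outside B y x (x|y ∘ sym))
               (oriented-outside B′ x t (λ eq → x|y′ (trans eq B′t≡B′y))) (oriented-outside B′ x y x|y′) (oriented-inside B′ x))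

  -- The colouring

  chain⇒star : ∀ {u v} p → Chain G p → Ends G p u v → Star Adj u v
  chain⇒star (x ∷ [])     _           (refl , refl) = ε
  chain⇒star (x ∷ y ∷ p) (xy , chain) (refl , ends) = xy ◅ chain⇒star (y ∷ p) chain (refl , ends)

  module _ {R : Rel (Fin n) 0ℓ} {k : ℕ} {colour : Fin n → Fin n → Fin k} (φ : Fin n → Fin k)
           (R⇒Adj : ∀ {a b} → R a b → Adj a b)
           (colour≡φ : ∀ {a b} → R a b → colour a b ≡ φ a)
           (φ-proper : ∀ {a b} → Adj a b → φ a ≢ φ b) where

    path⇒chain : ∀ {a p b} → Path R a p b → Chain G p
    path⇒chain stop       = tt
    path⇒chain (step r p) = R⇒Adj r , path⇒chain p

    -- The tails of consecutive arcs are adjacent, so `φ` gives them different colours.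
    path⇒properCol : ∀ {a p b} → Path R a p b → ProperCol G colour p
    path⇒properCol stop                = tt
    path⇒properCol (step _ stop)       = tt
    path⇒properCol (step r (step s p)) =
      (λ eq → φ-proper (R⇒Adj r) (trans (sym (colour≡φ r)) (trans eq (colour≡φ s)))) , path⇒properCol (step s p)

    simplePath⇒properPath : ∀ {a b} → SimplePath R a b → ProperPath G colour a b
    simplePath⇒properPath (p , path , unique) =
      p , unique , path⇒chain path , (path-head path , path-last path) , path⇒properCol path

  toFin : Bool → Fin 2
  toFin false = zero
  toFin true  = suc zero

  toFin-injective : ∀ {a b} → toFin a ≡ toFin b → a ≡ b
  toFin-injective {false} {false} _ = refl
  toFin-injective {true}  {true}  _ = refl

  unilateral⇒properConnected :
    (part : Fin n → Bool) → (∀ u v → Adj u v → part u ≢ part v) →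
    (R : Rel (Fin n) 0ℓ) → Decidable R → (∀ {a b} → R a b → Adj a b) → (∀ {a b} → R a b → ¬ R b a) →
    (∀ a b → Star R a b ⊎ Star R b a) → ProperConnectedWith G 2
  unilateral⇒properConnected part bipartite R R? R⇒Adj asym unilateral = (colour , colour-sym) , connect
    where
    tail-part : Fin n → Fin n → Bool
    tail-part a b = does (R? a b) ∧ part a
    -- By asymmetry at most one of the two terms belongs to an arc, so the disjunction is symmetric
    -- and still yields the part of the tail.
    colour : Fin n → Fin n → Fin 2
    colour a b = toFin (tail-part a b ∨ tail-part b a)
    colour-sym : ∀ a b → colour a b ≡ colour b a
    colour-sym a b = cong toFin (∨-comm (tail-part a b) (tail-part b a))
    colour-arc : ∀ {a b} → R a b → colour a b ≡ toFin (part a)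
    colour-arc {a} {b} r rewrite dec-true (R? a b) r | dec-false (R? b a) (asym r) = cong toFin (∨-identityʳ (part a))
    part-not : ∀ {a b} → Adj a b → part a ≡ not (part b)
    part-not {a} {b} e = ¬-not (bipartite a b e)
    connect : ∀ u v → u ≢ v → ProperPath G colour u v
    connect u v _ with unilateral u v
    ... | inj₁ s = simplePath⇒properPath (toFin ∘ part) R⇒Adj colour-arc
                     (λ e eq → bipartite _ _ e (toFin-injective eq))
                     (star⇒simplePath R? s)
    -- The directed path runs from `v` to `u`. Read backwards, the colour of an arc is the part of
    -- its second vertex, which is the negated part of its first.
    ... | inj₂ s = simplePath⇒properPath (toFin ∘ not ∘ part) (Adj-sym ∘ R⇒Adj)
                     (λ {a} {b} r → trans (colour-sym a b) (trans (colour-arc r) (cong toFin (part-not (R⇒Adj r)))))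
                     (λ e eq → bipartite _ _ e (not-injective (toFin-injective eq)))
                     (star⇒simplePath (flip R?) (reverse (λ r → r) s))

  -- With one colour a proper path has at most one edge, so it cannot join distinct nonadjacent
  -- vertices. With no colour, the colouring has no value at any pair.
  at-least-two-colours : ∀ {u v} → u ≢ v → ¬ Adj u v → ∀ k → ProperConnectedWith G k → 2 ≤ k
  at-least-two-colours {u} u≢v ¬uv zero ((c , _) , _) = case c u u of λ ()
  at-least-two-colours {u} {v} u≢v ¬uv (suc zero) ((c , _) , connect) with connect u v u≢v
  ... | x ∷ [] , _ , _ , (refl , refl) , _ = ⊥-elim (u≢v refl)
  ... | x ∷ y ∷ [] , _ , (xy , _) , (refl , refl) , _ = ⊥-elim (¬uv xy)
  ... | x ∷ y ∷ z ∷ p , _ , _ , _ , (differ , _) with c x y | c y z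
  ...   | zero | zero = ⊥-elim (differ refl)
  at-least-two-colours u≢v ¬uv (suc (suc k)) _ = s≤s (s≤s z≤n)

-- Two of the first three vertices share a part; being nonadjacent, they give the lower bound.
same-part : ∀ {n} → 4 ≤ n → (part : Fin n → Bool) → ∃ λ u → ∃ λ v → u ≢ v × part u ≡ part v
same-part (s≤s (s≤s (s≤s (s≤s _)))) part
  with part zero ≟ᵇ part (suc zero) | part zero ≟ᵇ part (suc (suc zero))
... | yes eq | _      = zero , suc zero , (λ ()) , eq
... | no _   | yes eq = zero , suc (suc zero) , (λ ()) , eq
... | no ne  | no ne′ = suc zero , suc (suc zero) , (λ ()) , not-injective (trans (sym (¬-not ne)) (¬-not ne′))

theorem9 : (n : ℕ) (G : Graph n) → Connected G → Bipartite G → 4 ≤ n →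
    (∀ v → n + 6 ≤ 8 * degree G v) → PcEq G 2
theorem9 n G connected (part , bipartite) 4≤n large-degree
  with same-part 4≤n part
... | u , v , u≢v , same =
  unilateral⇒properConnected G part bipartite Oriented Oriented? Oriented⇒Adj Oriented-asym unilateral ,
  at-least-two-colours G u≢v (λ uv → bipartite u v uv same)
  where
  walks : ∀ a b → Star (Adj G) a b
  walks a b = let p , chain , ends = connected a b in chain⇒star G p chain ends
  orientation = robbins G walks
  separation = DegreeCondition.common-separation G part bipartite 4≤n large-degree walks (proj₁ (proj₂ orientation)) u
  open Unilateral G walks (proj₁ orientation) (proj₁ (proj₂ orientation)) (proj₂ (proj₂ orientation))
    (proj₁ separation) (proj₁ (proj₂ separation)) (proj₂ (proj₂ separation))
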